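{- For every $n \in \mathbb{N}$, there is a finite simple digraph $D$ with $\vec{\chi}(D) \geq n$ and $\omega(D) \leq 3$ such that $D$ has no induced directed cycle of odd length at least $5$.
   Context: A digraph is simple if for any two distinct vertices $u,v$ it has at most one of the edges $uv$, $vu$ (and no loops). The underlying undirected graph of a digraph $D$ has vertex set $V(D)$, with $u,v$ adjacent iff $uv$ or $vu$ is an edge of $D$. The clique number $\omega(D)$ of a digraph is the clique number of its underlying undirected graph. A digraph is acyclic if it contains no directed cycle. A $k$-dicoloring of $D$ is a map $f:V(D)\to\{1,\dots,k\}$ such that each color class induces an acyclic subdigraph; the dichromatic number $\vec{\chi}(D)$ is the least $k$ for which a $k$-dicoloring exists. An induced directed cycle is a directed cycle $v_1v_2\cdots v_\ell v_1$ whose vertex set induces in $D$ a subdigraph with exactly the edges $v_iv_{i+1}$ (indices mod $\ell$). -}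

module Defs where

open import Data.Fin using (Fin; toℕ)
open import Data.Nat using (ℕ; suc; _≤_; _≥_; _%_; NonZero)
open import Data.Nat.DivMod using (_mod_)
open import Data.Product using (Σ; ∃; _×_; proj₁)
open import Data.Sum using (_⊎_; swap)
open import Function using (_↔_; _on_)
open import Function.Definitions using (Injective)
open import Level using (0ℓ)
open import Relation.Binary using (Rel; Decidable; Symmetric)
open import Relation.Binary.PropositionalEquality using (_≡_; _≢_)
open import Relation.Nullary using (¬_)

record Digraph : Set₁ where
  field
    Vertex : Set
    _⟶_    : Rel Vertex 0ℓ

-- Finiteness is separate from Digraph so that induced subdigraphs can be
-- formed on Σ-types. Decidability of the edge relation is automatic
-- classically; here it makes the edge set a finite set as well.
record IsFinite (D : Digraph) : Set where
  open Digraph D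
  field
    size        : ℕ
    enumeration : Vertex ↔ Fin size
    _⟶?_        : Decidable _⟶_

record IsSimple (D : Digraph) : Set where
  open Digraph D
  field
    loopless      : ∀ v → ¬ (v ⟶ v)
    atMostOneEdge : ∀ u v → u ≢ v → ¬ (u ⟶ v × v ⟶ u)

record Graph : Set₁ where
  field
    Vertex : Set
    _∼_    : Rel Vertex 0ℓ
    ∼-sym  : Symmetric _∼_

underlying : Digraph → Graph
underlying D = record
  { Vertex = Vertex
  ; _∼_    = λ u v → u ⟶ v ⊎ v ⟶ u
  ; ∼-sym  = swap
  }
  where open Digraph D

record Clique (G : Graph) (k : ℕ) : Set where
  open Graph G
  field
    vertex    : Fin k → Vertex
    injective : Injective _≡_ _≡_ vertex
    adjacent  : ∀ i j → i ≢ j → vertex i ∼ vertex j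

IsCliqueNumber : Graph → ℕ → Set
IsCliqueNumber G w = Clique G w × (∀ k → Clique G k → k ≤ w)

-- ω(D) = w
IsDigraphCliqueNumber : Digraph → ℕ → Set
IsDigraphCliqueNumber D = IsCliqueNumber (underlying D)

next : ∀ {ℓ} .{{_ : NonZero ℓ}} → Fin ℓ → Fin ℓ
next {ℓ} i = suc (toℕ i) mod ℓ

-- A loop is a directed cycle of length 1, a pair of antiparallel edges one of
-- length 2; neither occurs in a simple digraph.
record DirectedCycle (D : Digraph) : Set where
  open Digraph D
  field
    length      : ℕ
    {{nonZero}} : NonZero length
    vertex      : Fin length → Vertex
    injective   : Injective _≡_ _≡_ vertex
    edge        : ∀ i → vertex i ⟶ vertex (next i)

IsInduced : ∀ {D} → DirectedCycle D → Set
IsInduced {D} C = ∀ i j → vertex i ⟶ vertex j → j ≡ next i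
  where open Digraph D
        open DirectedCycle C

Acyclic : Digraph → Set
Acyclic D = ¬ DirectedCycle D

induced : (D : Digraph) → (Digraph.Vertex D → Set) → Digraph
induced D P = record
  { Vertex = Σ Vertex P
  ; _⟶_    = _⟶_ on proj₁
  }
  where open Digraph D

IsDicoloring : (D : Digraph) (k : ℕ) → (Digraph.Vertex D → Fin k) → Set
IsDicoloring D k f = ∀ c → Acyclic (induced D (λ v → f v ≡ c))

Dicolorable : Digraph → ℕ → Set
Dicolorable D k = ∃ (IsDicoloring D k)

-- χ⃗(D) = k
IsDichromaticNumber : Digraph → ℕ → Set
IsDichromaticNumber D k = Dicolorable D k × (∀ j → Dicolorable D j → k ≤ j)

Odd : ℕ → Set
Odd m = m % 2 ≡ 1

NoLongOddInducedCycle : Digraph → Set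
NoLongOddInducedCycle D =
  ¬ (∃ λ (C : DirectedCycle D) →
       IsInduced C × Odd (DirectedCycle.length C) × DirectedCycle.length C ≥ 5)

{-# OPTIONS --safe #-}
-- Start from Zykov's acyclic digraphs Z of large chromatic number, in which
-- any two vertices are joined by at most one directed path.  Let u ⟶ v if Z
-- has a path from u to v of length ≡ 1, or one from v to u of length ≡ 2
-- (mod 3).  Every path of length two of Z becomes a directed triangle, so an
-- acyclic class contains no such path and is properly 2-colourable in Z; hence
-- the dichromatic number is at least half the chromatic number of Z.  A clique
-- is a chain of Z, and the distances from its least element are distinct
-- modulo 3, so it has at most three vertices.  Two consecutive edges of a
-- directed cycle of the same kind (both along or both against Z) span a
-- triangle, so the two kinds alternate along an induced directed cycle of
-- length at least 4, whose length is therefore even.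
module Submission where

open import Defs
open import Data.Bool using (Bool; true; false; not)
open import Data.Bool.Properties using (not-involutive; not-¬)
open import Data.Empty using (⊥)
open import Data.Fin using (Fin; zero; suc; toℕ; fromℕ<; combine; finToFun; funToFin)
open import Data.Fin.Patterns using (0F; 1F; 2F)
open import Data.Fin.Properties using (_≟_; any?; all?; injective⇒≤; combine-injective; finToFun-funToFin; toℕ-fromℕ<; toℕ-injective; +↔⊎; *↔×; 0↔⊥; 1↔⊤)
open import Data.Nat using (ℕ; zero; suc; _+_; _*_; _%_; _/_; _≤_; _<_; _≥_; z≤n; s≤s; NonZero)
open import Data.Nat.DivMod using (_mod_; m%n<n; m≡m%n+[m/n]*n; m<n⇒m%n≡m; m%n%n≡m%n; n%n≡0; %-distribˡ-+)
open import Data.Nat.Properties using (+-comm; +-cancelʳ-≡; *-monoˡ-≤; m≤m+n; m≤n+m; ≤-trans; ≤-<-trans; ≮⇒≥; <⇒≤; <⇒≱; ≤-refl; 1+n≰n)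
open import Data.Product using (Σ; ∃; ∃₂; _×_; _,_; proj₁; proj₂)
open import Data.Product.Function.NonDependent.Propositional using (_×-↔_)
open import Data.Sum using (_⊎_; inj₁; inj₂)
open import Data.Sum.Function.Propositional using (_⊎-↔_)
open import Data.Unit using (⊤; tt)
open import Function using (_∘_; _↔_; Injective; Injection; Inverse)
open import Function.Properties.Inverse using (↔-sym; ↔-trans; ↔⇒↣)
open import Relation.Binary using (DecidableEquality)
open import Relation.Binary.PropositionalEquality using (_≡_; _≢_; _≗_; refl; sym; trans; cong; subst; subst₂; module ≡-Reasoning)
open import Relation.Nullary using (¬_; Dec; yes; no; contradiction)
open import Relation.Nullary.Decidable using (map′; ¬?; _×-dec_; _⊎-dec_; _→-dec_; via-injection; decidable-stable)

-- Finite search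

least : ∀ {P : ℕ → Set} → (∀ n → Dec (P n)) → ∀ n → P n →
        ∃ λ k → P k × (∀ j → P j → k ≤ j)
least P? n p with P? zero
least P? n       p | yes p₀ = zero , p₀ , λ _ _ → z≤n
least P? zero    p | no ¬p₀ = contradiction p ¬p₀
least P? (suc n) p | no ¬p₀ with k , q , min ← least (P? ∘ suc) n p =
  suc k , q , λ { zero r → contradiction r ¬p₀ ; (suc j) r → s≤s (min j r) }

minimum : ∀ {n} (_⊑_ : Fin (suc n) → Fin (suc n) → Set) →
          (∀ {i j k} → i ⊑ j → j ⊑ k → i ⊑ k) → (∀ i j → i ⊑ j ⊎ j ⊑ i) →
          ∃ λ i → ∀ j → i ⊑ j
minimum {zero} _⊑_ ⊑-trans total with total zero zero
... | inj₁ p = zero , λ { zero → p }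
... | inj₂ p = zero , λ { zero → p }
minimum {suc n} _⊑_ ⊑-trans total
  with i , min ← minimum (λ i j → suc i ⊑ suc j) ⊑-trans (λ i j → total (suc i) (suc j))
  with total zero zero | total zero (suc i)
... | _      | inj₂ p = suc i , λ { zero → p ; (suc j) → min j }
... | inj₁ r | inj₁ p = zero , λ { zero → r ; (suc j) → ⊑-trans p (min j) }
... | inj₂ r | inj₁ p = zero , λ { zero → r ; (suc j) → ⊑-trans p (min j) }

-- `finToFun (funToFin f)` agrees with `f` only pointwise, so `P` has to respect pointwise equality
-- for the search over codes to be complete.
anyFunction? : ∀ {m n} {P : (Fin m → Fin n) → Set} →
               (∀ {f g} → f ≗ g → P f → P g) → (∀ f → Dec (P f)) → Dec (∃ P)
anyFunction? resp P? =
  map′ (λ (c , p) → finToFun c , p)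
       (λ (f , p) → funToFin f , resp (sym ∘ finToFun-funToFin f) p)
       (any? (P? ∘ finToFun))

-- Search over finite types

Finite : Set → Set
Finite A = ∃ λ n → A ↔ Fin n

⊥-finite : Finite ⊥
⊥-finite = 0 , ↔-sym 0↔⊥

⊤-finite : Finite ⊤
⊤-finite = 1 , ↔-sym 1↔⊤

⊎-finite : ∀ {A B} → Finite A → Finite B → Finite (A ⊎ B)
⊎-finite (m , e) (n , f) = m + n , ↔-trans (e ⊎-↔ f) (↔-sym +↔⊎)

×-finite : ∀ {A B} → Finite A → Finite B → Finite (A × B)
×-finite (m , e) (n , f) = m * n , ↔-trans (e ×-↔ f) (↔-sym *↔×)

module _ {A : Set} (A-finite : Finite A) where
  open Inverse (proj₂ A-finite) using (to; from; strictlyInverseʳ)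

  finite-≟ : DecidableEquality A
  finite-≟ = via-injection (↔⇒↣ (proj₂ A-finite)) _≟_

  finite-any? : ∀ {P : A → Set} → (∀ x → Dec (P x)) → Dec (∃ P)
  finite-any? {P} P? =
    map′ (λ (i , p) → from i , p)
         (λ (x , p) → to x , subst P (sym (strictlyInverseʳ x)) p)
         (any? (P? ∘ from))

  anyFunctionInto? : ∀ {m} {P : (Fin m → A) → Set} →
                     (∀ {f g} → f ≗ g → P f → P g) → (∀ f → Dec (P f)) → Dec (∃ P)
  anyFunctionInto? resp P? =
    map′ (λ (f , p) → from ∘ f , p)
         (λ (f , p) → to ∘ f , resp (λ i → sym (strictlyInverseʳ (f i))) p)
         (anyFunction? (λ f≗g → resp (cong from ∘ f≗g)) (λ f → P? (from ∘ f)))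

  anyFunctionFrom? : ∀ {m} {P : (A → Fin m) → Set} →
                     (∀ {f g} → f ≗ g → P f → P g) → (∀ f → Dec (P f)) → Dec (∃ P)
  anyFunctionFrom? resp P? =
    map′ (λ (f , p) → f ∘ to , p)
         (λ (f , p) → f ∘ from , resp (λ x → cong f (sym (strictlyInverseʳ x))) p)
         (anyFunction? (λ f≗g → resp (f≗g ∘ to)) (λ f → P? (f ∘ to)))

-- Dicolorings of finite digraphs

module _ {D : Digraph} where
  open Digraph D
  open DirectedCycle

  -- Cycles of a colour class are treated as cycles of `D` with a condition on colours, so that a
  -- search can range over sequences of vertices of `D`.
  Monochromatic : ∀ {k} → (Vertex → Fin k) → Fin k → DirectedCycle D → Set
  Monochromatic f c C = ∀ i → f (vertex C i) ≡ c

  toInduced : ∀ {k} {f : Vertex → Fin k} {c} → ∃ (Monochromatic f c) →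
              DirectedCycle (induced D (λ v → f v ≡ c))
  toInduced (C , mono) = record
    { length    = length C
    ; vertex    = λ i → vertex C i , mono i
    ; injective = λ eq → injective C (cong proj₁ eq)
    ; edge      = edge C
    }

  fromInduced : ∀ {k} {f : Vertex → Fin k} {c} →
                DirectedCycle (induced D (λ v → f v ≡ c)) → ∃ (Monochromatic f c)
  fromInduced {f = f} {c} C = record
    { length    = length C
    ; vertex    = proj₁ ∘ vertex C
    ; injective = injective C ∘ Σ-≡
    ; edge      = edge C
    } , proj₂ ∘ vertex C
    where
    Σ-≡ : {x y : Σ Vertex (λ v → f v ≡ c)} → proj₁ x ≡ proj₁ y → x ≡ y
    Σ-≡ {_ , refl} {_ , refl} refl = refl

module _ {D : Digraph} (finite : IsFinite D) where
  open Digraph D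
  open DirectedCycle
  open IsFinite finite
  open Inverse enumeration using (to)

  private
    _≟ᵥ_ : DecidableEquality Vertex
    _≟ᵥ_ = finite-≟ (size , enumeration)

    to-injective : Injective _≡_ _≡_ to
    to-injective = Injection.injective (↔⇒↣ enumeration)

  length≤size : (C : DirectedCycle D) → length C ≤ size
  length≤size C = injective⇒≤ {f = to ∘ vertex C} (injective C ∘ to-injective)

  monochromatic? : ∀ {k} (f : Vertex → Fin k) c → Dec (∃ (Monochromatic f c))
  monochromatic? f c =
    map′ toCycle fromCycle
      (any? {n = size} λ l → anyFunctionInto? (size , enumeration) {P = IsCycle (toℕ l)} resp
        λ v → all? (λ i → all? λ j → (v i ≟ᵥ v j) →-dec (i ≟ j))
              ×-dec all? (λ i → v i ⟶? v (next i))
              ×-dec all? (λ i → f (v i) ≟ c))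
    where
    -- `l` is the length minus one: the lengths from 1 to `size` become `l < size`.
    IsCycle : ∀ l → (Fin (suc l) → Vertex) → Set
    IsCycle l v = (∀ i j → v i ≡ v j → i ≡ j) × (∀ i → v i ⟶ v (next i)) × (∀ i → f (v i) ≡ c)

    resp : ∀ {l v w} → v ≗ w → IsCycle l v → IsCycle l w
    resp eq (inj , edges , mono) =
      (λ i j p → inj i j (trans (eq i) (trans p (sym (eq j))))) ,
      (λ i → subst₂ _⟶_ (eq i) (eq (next i)) (edges i)) ,
      (λ i → trans (cong f (sym (eq i))) (mono i))

    toCycle : ∃ (λ (l : Fin size) → ∃ (IsCycle (toℕ l))) → ∃ (Monochromatic f c)
    toCycle (l , v , inj , edges , mono) = record
      { length = suc (toℕ l) ; vertex = v ; injective = inj _ _ ; edge = edges } , mono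

    shorten : ∀ {l} → l < size → ∃ (IsCycle l) → ∃ (λ (l : Fin size) → ∃ (IsCycle (toℕ l)))
    shorten l<size cyc = fromℕ< l<size , subst (∃ ∘ IsCycle) (sym (toℕ-fromℕ< l<size)) cyc

    fromCycle : ∃ (Monochromatic f c) → ∃ (λ (l : Fin size) → ∃ (IsCycle (toℕ l)))
    fromCycle (C@record { length = suc l ; vertex = v } , mono) =
      shorten (length≤size C) (v , (λ _ _ → injective C) , edge C , mono)

  dicolorable? : ∀ k → Dec (Dicolorable D k)
  dicolorable? k = anyFunctionFrom? (size , enumeration) resp
    λ f → all? λ c → ¬? (map′ toInduced fromInduced (monochromatic? f c))
    where
    resp : ∀ {f g} → f ≗ g → IsDicoloring D k f → IsDicoloring D k g
    resp f≗g dicoloring c C with C′ , mono ← fromInduced C =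
      dicoloring c (toInduced (C′ , λ i → trans (f≗g _) (mono i)))

  -- All colours are distinct, so the first edge of a monochromatic cycle would be a loop. This
  -- gives the search for the dichromatic number a place to stop.
  enumeration-dicoloring : IsSimple D → Dicolorable D size
  enumeration-dicoloring simple = to , λ c C → noLoop (fromInduced C)
    where
    noLoop : ∀ {c} → ¬ ∃ (Monochromatic to c)
    noLoop (C@record { length = suc l } , mono) = IsSimple.loopless simple _
      (subst (vertex C zero ⟶_) (to-injective (trans (mono _) (sym (mono zero)))) (edge C zero))

  dichromaticNumber : IsSimple D → ∃ (IsDichromaticNumber D)
  dichromaticNumber simple = least dicolorable? size (enumeration-dicoloring simple)

-- Walking around a cycle

module _ {ℓ : ℕ} .{{_ : NonZero ℓ}} where

  mod-≡ : ∀ {m n} → m % ℓ ≡ n % ℓ → m mod ℓ ≡ n mod ℓ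
  mod-≡ eq = toℕ-injective (trans (toℕ-fromℕ< _) (trans eq (sym (toℕ-fromℕ< _))))

  -- With positions written as `m mod ℓ`, walking around the cycle becomes induction on a natural
  -- number.
  next-mod : ∀ m → next (m mod ℓ) ≡ suc m mod ℓ
  next-mod m = mod-≡ (begin
    suc (toℕ (m mod ℓ)) % ℓ     ≡⟨ cong (λ x → suc x % ℓ) (toℕ-fromℕ< (m%n<n m ℓ)) ⟩
    (1 + m % ℓ) % ℓ             ≡⟨ %-distribˡ-+ 1 (m % ℓ) ℓ ⟩
    (1 % ℓ + m % ℓ % ℓ) % ℓ     ≡⟨ cong (λ x → (1 % ℓ + x) % ℓ) (m%n%n≡m%n m ℓ) ⟩
    (1 % ℓ + m % ℓ) % ℓ         ≡⟨ %-distribˡ-+ 1 m ℓ ⟨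
    suc m % ℓ                   ∎)
    where open ≡-Reasoning

  -- Coming back after three steps would make 3 a positive multiple of `ℓ`.
  next³-≢ : 4 ≤ ℓ → (i : Fin ℓ) → i ≢ next (next (next i))
  next³-≢ 4≤ℓ i eq = impossible ((3 + toℕ i) / ℓ) (begin
    3 + toℕ i                                ≡⟨ m≡m%n+[m/n]*n (3 + toℕ i) ℓ ⟩
    (3 + toℕ i) % ℓ + (3 + toℕ i) / ℓ * ℓ    ≡⟨ cong (_+ (3 + toℕ i) / ℓ * ℓ) fixed ⟩
    toℕ i + (3 + toℕ i) / ℓ * ℓ              ≡⟨ +-comm (toℕ i) _ ⟩
    (3 + toℕ i) / ℓ * ℓ + toℕ i              ∎)
    where
    open ≡-Reasoning
    fixed : (3 + toℕ i) % ℓ ≡ toℕ i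
    fixed = begin
      (3 + toℕ i) % ℓ             ≡⟨ toℕ-fromℕ< _ ⟨
      toℕ ((3 + toℕ i) mod ℓ)     ≡⟨ cong toℕ (trans (cong next (next-mod (1 + toℕ i))) (next-mod (2 + toℕ i))) ⟨
      toℕ (next (next (next i)))  ≡⟨ cong toℕ eq ⟨
      toℕ i                       ∎

    impossible : ∀ q → 3 + toℕ i ≢ q * ℓ + toℕ i
    impossible q e with q | +-cancelʳ-≡ (toℕ i) 3 (q * ℓ) e
    ... | zero  | ()
    ... | suc q | 3≡ℓ+qℓ = 1+n≰n (≤-trans 4≤ℓ (subst (ℓ ≤_) (sym 3≡ℓ+qℓ) (m≤m+n ℓ (q * ℓ))))

alternating-odd : ∀ {b : ℕ → Bool} → (∀ m → b (suc m) ≡ not (b m)) → ∀ ℓ → Odd ℓ → b ℓ ≡ not (b 0)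
alternating-odd alt 1             _   = alt 0
alternating-odd alt (suc (suc ℓ)) odd =
  trans (alt _) (trans (cong not (alt ℓ))
    (trans (not-involutive _) (alternating-odd alt ℓ odd)))

-- After `ℓ` steps the walk is back at its start, but an odd number of flips has changed `b`.
no-odd-alternation : ∀ {ℓ} .{{_ : NonZero ℓ}} {b : Fin ℓ → Bool} →
                     (∀ i → b (next i) ≡ not (b i)) → ¬ Odd ℓ
no-odd-alternation {ℓ} {b} alt odd =
  not-¬ (cong b (mod-≡ {m = ℓ} {n = 0} (trans (n%n≡0 ℓ) (sym (m<n⇒m%n≡m 0<ℓ)))))
        (alternating-odd {λ m → b (m mod ℓ)} (λ m → trans (cong b (sym (next-mod m))) (alt _)) ℓ odd)
  where
  0<ℓ : 0 < ℓ
  0<ℓ = ≤-<-trans z≤n (m%n<n 0 ℓ)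

-- Path lengths modulo 3

rotate : Fin 3 → Fin 3
rotate 0F = 1F
rotate 1F = 2F
rotate 2F = 0F

-- Addition in ℤ/3, given by cases so that the sums 1 + 1 = 2 and 2 + 2 = 1 behind the triangles
-- hold by computation.
_⊕_ : Fin 3 → Fin 3 → Fin 3
0F ⊕ b = b
1F ⊕ b = rotate b
2F ⊕ b = rotate (rotate b)

⊕-identityʳ : ∀ a → a ⊕ 0F ≡ a
⊕-identityʳ 0F = refl
⊕-identityʳ 1F = refl
⊕-identityʳ 2F = refl

⊕-rotate : ∀ a b → a ⊕ rotate b ≡ rotate (a ⊕ b)
⊕-rotate 0F b = refl
⊕-rotate 1F b = refl
⊕-rotate 2F b = refl

⊕-fixed : ∀ a b → a ⊕ b ≡ a → b ≡ 0F
⊕-fixed a  0F _  = refl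
⊕-fixed 0F 1F ()
⊕-fixed 1F 1F ()
⊕-fixed 2F 1F ()
⊕-fixed 0F 2F ()
⊕-fixed 1F 2F ()
⊕-fixed 2F 2F ()

-- u ⊑⟨ a ⟩ v models "the directed path from u to v exists and its length is a
-- modulo 3"; the trivial path is included.
record PathSystem : Set₁ where
  field
    Vertex     : Set
    _⊑⟨_⟩_     : Vertex → Fin 3 → Vertex → Set
    ⊑-refl     : ∀ {u} → u ⊑⟨ 0F ⟩ u
    ⊑-trans    : ∀ {u v w a b} → u ⊑⟨ a ⟩ v → v ⊑⟨ b ⟩ w → u ⊑⟨ a ⊕ b ⟩ w
    ⊑-unique   : ∀ {u v a b} → u ⊑⟨ a ⟩ v → u ⊑⟨ b ⟩ v → a ≡ b
    ⊑-antisym  : ∀ {u v a b} → u ⊑⟨ a ⟩ v → v ⊑⟨ b ⟩ u → a ≡ 0F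
    ⊑?         : ∀ u a v → Dec (u ⊑⟨ a ⟩ v)
    finite     : Finite Vertex

-- The digraph of a path system: simplicity, cliques, induced cycles

module _ (P : PathSystem) where
  open PathSystem P

  data _⟶_ (u v : Vertex) : Set where
    up   : u ⊑⟨ 1F ⟩ v → u ⟶ v
    down : v ⊑⟨ 2F ⟩ u → u ⟶ v

  cyclic : Digraph
  cyclic = record { Vertex = Vertex ; _⟶_ = _⟶_ }

  cyclic-finite : IsFinite cyclic
  cyclic-finite = record
    { size        = proj₁ finite
    ; enumeration = proj₂ finite
    ; _⟶?_        = λ u v → map′ (λ { (inj₁ p) → up p ; (inj₂ p) → down p })
                                 (λ { (up p) → inj₁ p ; (down p) → inj₂ p })
                                 (⊑? u 1F v ⊎-dec ⊑? v 2F u)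
    }

  loopless : ∀ {u} → ¬ u ⟶ u
  loopless (up p)   with () ← ⊑-unique p ⊑-refl
  loopless (down p) with () ← ⊑-unique p ⊑-refl

  asymmetric : ∀ {u v} → u ⟶ v → ¬ v ⟶ u
  asymmetric (up p)   (up q)   with () ← ⊑-antisym p q
  asymmetric (up p)   (down q) with () ← ⊑-unique p q
  asymmetric (down p) (up q)   with () ← ⊑-unique p q
  asymmetric (down p) (down q) with () ← ⊑-antisym p q

  cyclic-simple : IsSimple cyclic
  cyclic-simple = record
    { loopless      = λ _ → loopless
    ; atMostOneEdge = λ { _ _ _ (p , q) → asymmetric p q }
    }

  clique-≤3 : ∀ k → Clique (underlying cyclic) k → k ≤ 3
  clique-≤3 zero    K = z≤n
  clique-≤3 (suc k) K = injective⇒≤ {f = height} height-injective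
    where
    open Clique K

    Comparable : Vertex → Vertex → Set
    Comparable u v = ∃ λ a → u ⊑⟨ a ⟩ v

    chain : ∀ i j → i ≢ j → ∃ λ a → a ≢ 0F × (vertex i ⊑⟨ a ⟩ vertex j ⊎ vertex j ⊑⟨ a ⟩ vertex i)
    chain i j i≢j with adjacent i j i≢j
    ... | inj₁ (up p)   = 1F , (λ ()) , inj₁ p
    ... | inj₁ (down p) = 2F , (λ ()) , inj₂ p
    ... | inj₂ (up p)   = 1F , (λ ()) , inj₂ p
    ... | inj₂ (down p) = 2F , (λ ()) , inj₁ p

    total : ∀ i j → Comparable (vertex i) (vertex j) ⊎ Comparable (vertex j) (vertex i)
    total i j with i ≟ j
    ... | yes refl = inj₁ (0F , ⊑-refl)
    ... | no i≢j with chain i j i≢j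
    ...   | a , _ , inj₁ p = inj₁ (a , p)
    ...   | a , _ , inj₂ p = inj₂ (a , p)

    bottom : ∃ λ m → ∀ j → Comparable (vertex m) (vertex j)
    bottom = minimum (λ i j → Comparable (vertex i) (vertex j))
                     (λ { (_ , p) (_ , q) → _ , ⊑-trans p q }) total

    height : Fin (suc k) → Fin 3
    height j = proj₁ (proj₂ bottom j)

    -- Going from the bottom to `vertex j` through `vertex i` has residue `height i ⊕ a`, which by
    -- uniqueness is `height j`.
    height-separates : ∀ {i j a} → vertex i ⊑⟨ a ⟩ vertex j → height i ≡ height j → a ≡ 0F
    height-separates {i} {j} p eq = ⊕-fixed _ _
      (trans (⊑-unique (⊑-trans (proj₂ (proj₂ bottom i)) p) (proj₂ (proj₂ bottom j))) (sym eq))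

    height-injective : Injective _≡_ _≡_ height
    height-injective {i} {j} eq with i ≟ j
    ... | yes i≡j = i≡j
    ... | no  i≢j with chain i j i≢j
    ...   | _ , a≢0 , inj₁ p = contradiction (height-separates p eq) a≢0
    ...   | _ , a≢0 , inj₂ p = contradiction (height-separates p (sym eq)) a≢0

  noLongOddInducedCycle : NoLongOddInducedCycle cyclic
  noLongOddInducedCycle (C , ind , odd , 5≤ℓ) =
    no-odd-alternation {b = λ i → isUp (edge i)} (λ i → alternate i (edge i) (edge (next i))) odd
    where
    open DirectedCycle C

    isUp : ∀ {u v} → u ⟶ v → Bool
    isUp (up _)   = true
    isUp (down _) = false

    -- `ind` makes such an edge a step of the cycle, so `i` would be three steps after itself.
    noTriangle : ∀ i → ¬ vertex (next (next i)) ⟶ vertex i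
    noTriangle i e = next³-≢ (≤-trans (m≤n+m 4 1) 5≤ℓ) i (ind _ _ e)

    alternate : ∀ i (e : vertex i ⟶ vertex (next i)) (e′ : vertex (next i) ⟶ vertex (next (next i))) →
                isUp e′ ≡ not (isUp e)
    alternate i (up p)   (down q) = refl
    alternate i (down p) (up q)   = refl
    -- Two upward edges compose to residue 2 and two downward ones to residue 1; either way there is
    -- an edge back to the start.
    alternate i (up p)   (up q)   = contradiction (down (⊑-trans p q)) (noTriangle i)
    alternate i (down p) (down q) = contradiction (up (⊑-trans q p)) (noTriangle i)

  -- Triangles, monochromatic edges and monochromatic paths

  HasMonochromaticEdge : ∀ {k} → (Vertex → Fin k) → Set
  HasMonochromaticEdge f = ∃₂ λ u v → u ⊑⟨ 1F ⟩ v × f u ≡ f v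

  HasMonochromaticPath : ∀ {k} → (Vertex → Fin k) → Set
  HasMonochromaticPath f = ∃₂ λ u v → ∃ λ w →
    u ⊑⟨ 1F ⟩ v × v ⊑⟨ 1F ⟩ w × f u ≡ f v × f v ≡ f w

  triangle : ∀ {u v w} → u ⊑⟨ 1F ⟩ v → v ⊑⟨ 1F ⟩ w → DirectedCycle cyclic
  triangle {u} {v} {w} p q = record
    { length    = 3
    ; vertex    = corner
    ; injective = corner-injective _ _
    ; edge      = λ { 0F → up p ; 1F → up q ; 2F → w⟶u }
    }
    where
    w⟶u : w ⟶ u
    w⟶u = down (⊑-trans p q)

    corner : Fin 3 → Vertex
    corner 0F = u
    corner 1F = v
    corner 2F = w

    ≢-edge : ∀ {x y} → x ⟶ y → x ≢ y
    ≢-edge e refl = loopless e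

    corner-injective : ∀ i j → corner i ≡ corner j → i ≡ j
    corner-injective 0F 0F _  = refl
    corner-injective 1F 1F _  = refl
    corner-injective 2F 2F _  = refl
    corner-injective 0F 1F eq = contradiction eq (≢-edge (up p))
    corner-injective 1F 2F eq = contradiction eq (≢-edge (up q))
    corner-injective 2F 0F eq = contradiction eq (≢-edge w⟶u)
    corner-injective 1F 0F eq = contradiction (sym eq) (≢-edge (up p))
    corner-injective 2F 1F eq = contradiction (sym eq) (≢-edge (up q))
    corner-injective 0F 2F eq = contradiction (sym eq) (≢-edge w⟶u)

  -- A clique number has to be attained; this clique attains the bound 3.
  triangle-clique : ∀ {u v w} → u ⊑⟨ 1F ⟩ v → v ⊑⟨ 1F ⟩ w → Clique (underlying cyclic) 3
  triangle-clique p q = record { vertex = vertex ; injective = injective ; adjacent = adjacent }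
    where
    open DirectedCycle (triangle p q)
    adjacent : ∀ i j → i ≢ j → vertex i ⟶ vertex j ⊎ vertex j ⟶ vertex i
    adjacent 0F 0F i≢j = contradiction refl i≢j
    adjacent 1F 1F i≢j = contradiction refl i≢j
    adjacent 2F 2F i≢j = contradiction refl i≢j
    adjacent 0F 1F _   = inj₁ (edge 0F)
    adjacent 1F 2F _   = inj₁ (edge 1F)
    adjacent 2F 0F _   = inj₁ (edge 2F)
    adjacent 1F 0F _   = inj₂ (edge 0F)
    adjacent 2F 1F _   = inj₂ (edge 1F)
    adjacent 0F 2F _   = inj₂ (edge 2F)

  dicoloring⇒noPath : ∀ {k f} → IsDicoloring cyclic k f → ¬ HasMonochromaticPath f
  dicoloring⇒noPath dicoloring (u , v , w , p , q , fu≡fv , fv≡fw) =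
    dicoloring _ (toInduced (triangle p q , λ
      { 0F → trans fu≡fv fv≡fw ; 1F → fv≡fw ; 2F → refl }))

  -- The second component of the refined colour records whether the vertex has
  -- an out-neighbour of its own colour: a simple case of the Gallai–Roy theorem.
  path-from-edge : ∀ {k} (f : Vertex → Fin k) →
                   (∀ (g : Vertex → Fin (k * 2)) → HasMonochromaticEdge g) →
                   HasMonochromaticPath f
  path-from-edge f monoEdge = extend (monoEdge (λ v → combine (f v) (bit (continues? v))))
    where
    Continues : Vertex → Set
    Continues v = ∃ λ w → v ⊑⟨ 1F ⟩ w × f v ≡ f w

    continues? : ∀ v → Dec (Continues v)
    continues? v = finite-any? finite λ w → ⊑? v 1F w ×-dec (f v ≟ f w)

    bit : ∀ {A : Set} → Dec A → Fin 2
    bit (yes _) = 1F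
    bit (no _)  = 0F

    transfer : ∀ {A B : Set} (a : Dec A) (b : Dec B) → bit a ≡ bit b → A → B
    transfer (yes _) (yes b) _  _ = b
    transfer (no ¬a) _       _  a = contradiction a ¬a

    extend : HasMonochromaticEdge (λ v → combine (f v) (bit (continues? v))) → HasMonochromaticPath f
    extend (u , v , p , eq)
      with fu≡fv , bits ← combine-injective (f u) (bit (continues? u)) (f v) (bit (continues? v)) eq
      -- The edge to `v` shows that `u` continues; equal bits make `v` continue too, which gives the
      -- third vertex `w`.
      with w , q , fv≡fw ← transfer (continues? u) (continues? v) bits (v , p , fu≡fv)
      = u , v , w , p , q , fu≡fv , fv≡fw

-- Zykov's construction

-- A transversal t stands for a choice of one vertex in each component, and
-- u ⟿⟨ a ⟩ t says that u reaches a vertex of t by a path of length a modulo 3.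
record Transversals (P : PathSystem) : Set₁ where
  open PathSystem P
  field
    Transversal : Set
    _⟿⟨_⟩_      : Vertex → Fin 3 → Transversal → Set
    ⟿-trans     : ∀ {u v t a b} → u ⊑⟨ a ⟩ v → v ⟿⟨ b ⟩ t → u ⟿⟨ a ⊕ b ⟩ t
    ⟿-unique    : ∀ {u t a b} → u ⟿⟨ a ⟩ t → u ⟿⟨ b ⟩ t → a ≡ b
    ⟿?          : ∀ u a t → Dec (u ⟿⟨ a ⟩ t)
    T-finite    : Finite Transversal

-- Cones: a new sink over every transversal

module _ {P : PathSystem} (𝒯 : Transversals P) where
  open PathSystem P
  open Transversals 𝒯

  module Cone where
    -- A path to the apex of `t` ends with one edge from a vertex of `t`, hence the `rotate` in
    -- `new`. An apex reaches only itself.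
    data _≼⟨_⟩_ : Vertex ⊎ Transversal → Fin 3 → Vertex ⊎ Transversal → Set where
      old  : ∀ {u v a} → u ⊑⟨ a ⟩ v → inj₁ u ≼⟨ a ⟩ inj₁ v
      new  : ∀ {u t a} → u ⟿⟨ a ⟩ t → inj₁ u ≼⟨ rotate a ⟩ inj₂ t
      stay : ∀ {t} → inj₂ t ≼⟨ 0F ⟩ inj₂ t

    ≼-refl : ∀ {x} → x ≼⟨ 0F ⟩ x
    ≼-refl {inj₁ _} = old ⊑-refl
    ≼-refl {inj₂ _} = stay

    ≼-trans : ∀ {x y z a b} → x ≼⟨ a ⟩ y → y ≼⟨ b ⟩ z → x ≼⟨ a ⊕ b ⟩ z
    ≼-trans (old p) (old q) = old (⊑-trans p q)
    ≼-trans {a = a} (old p) (new {a = b} q) = subst (λ c → _ ≼⟨ c ⟩ _) (sym (⊕-rotate a b)) (new (⟿-trans p q))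
    ≼-trans {a = a} p stay = subst (λ c → _ ≼⟨ c ⟩ _) (sym (⊕-identityʳ a)) p

    ≼-unique : ∀ {x y a b} → x ≼⟨ a ⟩ y → x ≼⟨ b ⟩ y → a ≡ b
    ≼-unique (old p) (old q) = ⊑-unique p q
    ≼-unique (new p) (new q) = cong rotate (⟿-unique p q)
    ≼-unique stay    stay    = refl

    ≼-antisym : ∀ {x y a b} → x ≼⟨ a ⟩ y → y ≼⟨ b ⟩ x → a ≡ 0F
    ≼-antisym (old p) (old q) = ⊑-antisym p q
    ≼-antisym stay    _       = refl

    ≼? : ∀ x a y → Dec (x ≼⟨ a ⟩ y)
    ≼? (inj₁ u) a (inj₁ v) = map′ old (λ { (old p) → p }) (⊑? u a v)
    ≼? (inj₁ u) a (inj₂ t) = map′ (λ { (_ , p , refl) → new p }) (λ { (new p) → _ , p , refl })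
                                  (any? λ b → ⟿? u b t ×-dec (a ≟ rotate b))
    ≼? (inj₂ t) a (inj₁ v) = no λ ()
    ≼? (inj₂ t) a (inj₂ s) = map′ (λ { (refl , refl) → stay }) (λ { stay → refl , refl })
                                  (finite-≟ T-finite t s ×-dec (a ≟ 0F))

  cone : PathSystem
  cone = record
    { Vertex    = Vertex ⊎ Transversal
    ; _⊑⟨_⟩_    = _≼⟨_⟩_
    ; ⊑-refl    = ≼-refl
    ; ⊑-trans   = ≼-trans
    ; ⊑-unique  = ≼-unique
    ; ⊑-antisym = ≼-antisym
    ; ⊑?        = ≼?
    ; finite    = ⊎-finite finite T-finite
    }
    where open Cone

-- Disjoint unions and their transversals

module _ (P Q : PathSystem) where
  private
    module P = PathSystem P
    module Q = PathSystem Q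

  module Union where
    data _≼⟨_⟩_ : P.Vertex ⊎ Q.Vertex → Fin 3 → P.Vertex ⊎ Q.Vertex → Set where
      left  : ∀ {u v a} → u P.⊑⟨ a ⟩ v → inj₁ u ≼⟨ a ⟩ inj₁ v
      right : ∀ {u v a} → u Q.⊑⟨ a ⟩ v → inj₂ u ≼⟨ a ⟩ inj₂ v

    ≼-refl : ∀ {x} → x ≼⟨ 0F ⟩ x
    ≼-refl {inj₁ _} = left P.⊑-refl
    ≼-refl {inj₂ _} = right Q.⊑-refl

    ≼-trans : ∀ {x y z a b} → x ≼⟨ a ⟩ y → y ≼⟨ b ⟩ z → x ≼⟨ a ⊕ b ⟩ z
    ≼-trans (left p)  (left q)  = left (P.⊑-trans p q)
    ≼-trans (right p) (right q) = right (Q.⊑-trans p q)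

    ≼-unique : ∀ {x y a b} → x ≼⟨ a ⟩ y → x ≼⟨ b ⟩ y → a ≡ b
    ≼-unique (left p)  (left q)  = P.⊑-unique p q
    ≼-unique (right p) (right q) = Q.⊑-unique p q

    ≼-antisym : ∀ {x y a b} → x ≼⟨ a ⟩ y → y ≼⟨ b ⟩ x → a ≡ 0F
    ≼-antisym (left p)  (left q)  = P.⊑-antisym p q
    ≼-antisym (right p) (right q) = Q.⊑-antisym p q

    ≼? : ∀ x a y → Dec (x ≼⟨ a ⟩ y)
    ≼? (inj₁ u) a (inj₁ v) = map′ left (λ { (left p) → p }) (P.⊑? u a v)
    ≼? (inj₁ u) a (inj₂ v) = no λ ()
    ≼? (inj₂ u) a (inj₁ v) = no λ ()
    ≼? (inj₂ u) a (inj₂ v) = map′ right (λ { (right p) → p }) (Q.⊑? u a v)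

  open Union

  union : PathSystem
  union = record
    { Vertex    = P.Vertex ⊎ Q.Vertex
    ; _⊑⟨_⟩_    = _≼⟨_⟩_
    ; ⊑-refl    = ≼-refl
    ; ⊑-trans   = ≼-trans
    ; ⊑-unique  = ≼-unique
    ; ⊑-antisym = ≼-antisym
    ; ⊑?        = ≼?
    ; finite    = ⊎-finite P.finite Q.finite
    }

  module Adjoin (𝒯 : Transversals P) where
    open Transversals 𝒯

    -- `Q` counts as one further component, so a transversal of the union is one of `P` together
    -- with a chosen vertex of `Q`.
    data _↝⟨_⟩_ : P.Vertex ⊎ Q.Vertex → Fin 3 → Transversal × Q.Vertex → Set where
      left  : ∀ {u a t v} → u ⟿⟨ a ⟩ t → inj₁ u ↝⟨ a ⟩ (t , v)
      right : ∀ {u a t v} → u Q.⊑⟨ a ⟩ v → inj₂ u ↝⟨ a ⟩ (t , v)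

    ↝-trans : ∀ {x y t a b} → x ≼⟨ a ⟩ y → y ↝⟨ b ⟩ t → x ↝⟨ a ⊕ b ⟩ t
    ↝-trans (left p)  (left q)  = left (⟿-trans p q)
    ↝-trans (right p) (right q) = right (Q.⊑-trans p q)

    ↝-unique : ∀ {x t a b} → x ↝⟨ a ⟩ t → x ↝⟨ b ⟩ t → a ≡ b
    ↝-unique (left p)  (left q)  = ⟿-unique p q
    ↝-unique (right p) (right q) = Q.⊑-unique p q

    ↝? : ∀ x a t → Dec (x ↝⟨ a ⟩ t)
    ↝? (inj₁ u) a (t , v) = map′ left (λ { (left p) → p }) (⟿? u a t)
    ↝? (inj₂ u) a (t , v) = map′ right (λ { (right p) → p }) (Q.⊑? u a v)

  adjoin : Transversals P → Transversals union
  adjoin 𝒯 = record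
    { Transversal = Transversal × Q.Vertex
    ; _⟿⟨_⟩_      = _↝⟨_⟩_
    ; ⟿-trans     = ↝-trans
    ; ⟿-unique    = ↝-unique
    ; ⟿?          = ↝?
    ; T-finite    = ×-finite T-finite Q.finite
    }
    where
    open Transversals 𝒯
    open Adjoin 𝒯

-- Rainbow transversals in proper colourings

RainbowTransversal : ∀ {P} → Transversals P → ∀ n {k} → (PathSystem.Vertex P → Fin k) → Set
RainbowTransversal {P} 𝒯 n f =
  ∃₂ λ t (g : Fin n → Vertex) → Injective _≡_ _≡_ (f ∘ g) × (∀ i → g i ⟿⟨ 0F ⟩ t)
  where
  open PathSystem P
  open Transversals 𝒯

-- The induction carries more than a lower bound on the number of colours: the `n` colours have to
-- lie on a single transversal, where one apex is joined to all of them.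
Rainbow : ∀ {P} → Transversals P → ℕ → Set
Rainbow {P} 𝒯 n = ∀ {k} (f : PathSystem.Vertex P → Fin k) →
                  HasMonochromaticEdge P f ⊎ RainbowTransversal 𝒯 n f

-- Pigeonhole: otherwise matching equal values would inject `Fin (suc m)` into `Fin m`.
fresh-value : ∀ {m k} (f : Fin m → Fin k) (g : Fin (suc m) → Fin k) →
              Injective _≡_ _≡_ g → ∃ λ i → ∀ j → g i ≢ f j
fresh-value f g g-inj with any? (λ i → all? (λ j → ¬? (g i ≟ f j)))
... | yes found = found
... | no ¬found = contradiction (injective⇒≤ {f = proj₁ ∘ hit} hit-injective) 1+n≰n
  where
  hit : ∀ i → ∃ λ j → g i ≡ f j
  hit i = decidable-stable (any? λ j → g i ≟ f j) λ ¬hit → ¬found (i , λ j eq → ¬hit (j , eq))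

  hit-injective : Injective _≡_ _≡_ (proj₁ ∘ hit)
  hit-injective {i} {i′} eq = g-inj (trans (proj₂ (hit i)) (trans (cong f eq) (sym (proj₂ (hit i′)))))

cons : ∀ {A : Set} {n} → A → (Fin n → A) → Fin (suc n) → A
cons x g zero    = x
cons x g (suc i) = g i

cons-injective : ∀ {A B : Set} {n} (f : A → B) {x : A} {g : Fin n → A} →
                 Injective _≡_ _≡_ (f ∘ g) → (∀ j → f x ≢ f (g j)) →
                 Injective _≡_ _≡_ (f ∘ cons x g)
cons-injective f inj x≢ {zero}  {zero}  _  = refl
cons-injective f inj x≢ {zero}  {suc j} eq = contradiction eq (x≢ j)
cons-injective f inj x≢ {suc i} {zero}  eq = contradiction (sym eq) (x≢ i)
cons-injective f inj x≢ {suc i} {suc j} eq = cong suc (inj eq)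

module _ {P : PathSystem} (𝒯 : Transversals P) where

  -- In a proper colouring of the cone, a rainbow transversal and its apex show
  -- n + 1 colours, so one of them is missing from a rainbow transversal of P.
  rainbow-step : ∀ {n} → Rainbow 𝒯 n → Rainbow (adjoin P (cone 𝒯) 𝒯) (suc n)
  rainbow-step {n} rainbow f with rainbow (f ∘ inj₁) | rainbow (f ∘ inj₂ ∘ inj₁)
  ... | inj₁ (u , v , p , eq) | _ = inj₁ (inj₁ u , inj₁ v , Union.left p , eq)
  ... | _ | inj₁ (u , v , p , eq) = inj₁ (inj₂ (inj₁ u) , inj₂ (inj₁ v) , Union.right (Cone.old p) , eq)
  ... | inj₂ (t , g , g-inj , g∈t) | inj₂ (s , h , h-inj , h∈s)
    with any? (λ i → f (inj₂ (inj₁ (h i))) ≟ f (inj₂ (inj₂ s)))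
  -- `h i` reaches `s` with residue 0, so it reaches the apex with residue 1, and that is the
  -- monochromatic edge.
  ...   | yes (i , eq) = inj₁ (inj₂ (inj₁ (h i)) , inj₂ (inj₂ s) , Union.right (Cone.new (h∈s i)) , eq)
  ...   | no apex-fresh
    with fresh-value (f ∘ inj₁ ∘ g) (f ∘ inj₂ ∘ cons (inj₂ s) (inj₁ ∘ h))
           (cons-injective (f ∘ inj₂) h-inj λ j eq → apex-fresh (j , sym eq))
  ...     | i , i-fresh = inj₂
    -- Choosing in the cone the vertex `x` whose colour is missing from `g` adds one colour to those
    -- on `t`.
    ( (t , x) , cons (inj₂ x) (inj₁ ∘ g) , cons-injective f g-inj i-fresh
    , λ { zero → Adjoin.right (Cone.≼-refl 𝒯) ; (suc j) → Adjoin.left (g∈t j) } )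
    where x = cons (inj₂ s) (inj₁ ∘ h) i

zykov : ∀ n → ∃ λ P → Σ (Transversals P) λ 𝒯 → Rainbow 𝒯 n
-- The empty system has one transversal, the empty choice, so the first cone is a single vertex.
zykov zero = record
  { Vertex    = ⊥
  ; _⊑⟨_⟩_    = λ _ _ _ → ⊥
  ; ⊑-refl    = λ { {()} }
  ; ⊑-trans   = λ ()
  ; ⊑-unique  = λ ()
  ; ⊑-antisym = λ ()
  ; ⊑?        = λ ()
  ; finite    = ⊥-finite
  } , record
  { Transversal = ⊤
  ; _⟿⟨_⟩_      = λ _ _ _ → ⊥
  ; ⟿-trans     = λ ()
  ; ⟿-unique    = λ ()
  ; ⟿?          = λ ()
  ; T-finite    = ⊤-finite
  } , λ _ → inj₂ (tt , (λ ()) , (λ { {()} }) , λ ())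
-- Unfolded, each stage is the disjoint union of the cones over all earlier stages; these are the
-- components in which a transversal chooses.
zykov (suc n) with P , 𝒯 , rainbow ← zykov n =
  union P (cone 𝒯) , adjoin P (cone 𝒯) 𝒯 , rainbow-step 𝒯 rainbow

-- The lower bound and the conclusion

rainbow⇒monochromaticEdge : ∀ {P n k} {𝒯 : Transversals P} → Rainbow 𝒯 n → k < n →
                            (f : PathSystem.Vertex P → Fin k) → HasMonochromaticEdge P f
rainbow⇒monochromaticEdge rainbow k<n f with rainbow f
... | inj₁ edge            = edge
... | inj₂ (_ , _ , inj , _) = contradiction (injective⇒≤ inj) (<⇒≱ k<n)

theorem1p5 : (n : ℕ) → Σ Digraph (λ D → IsFinite D × IsSimple D
    × (∃ λ χ → IsDichromaticNumber D χ × χ ≥ n)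
    × (∃ λ ω → IsDigraphCliqueNumber D ω × ω ≤ 3)
    × NoLongOddInducedCycle D)
-- `path-from-edge` doubles the number of colours, hence `n * 2`. The summand 3 makes one colour,
-- doubled to 2, too few even for `n = 0`, so that a triangle always exists.
theorem1p5 n with P , 𝒯 , rainbow ← zykov (3 + n * 2) =
  cyclic P , cyclic-finite P , cyclic-simple P
  , (χ , isχ , ≮⇒≥ λ χ<n →
      let f , dicoloring = proj₁ isχ in
      dicoloring⇒noPath P dicoloring (path f (≤-trans (s≤s (*-monoˡ-≤ 2 (<⇒≤ χ<n))) (m≤n+m _ 2))))
  , (3 , (clique₃ , clique-≤3 P) , ≤-refl)
  , noLongOddInducedCycle P
  where
  dichromatic : ∃ (IsDichromaticNumber (cyclic P))
  dichromatic = dichromaticNumber (cyclic-finite P) (cyclic-simple P)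

  χ = proj₁ dichromatic
  isχ = proj₂ dichromatic

  path : ∀ {k} (f : PathSystem.Vertex P → Fin k) → k * 2 < 3 + n * 2 → HasMonochromaticPath P f
  path f small = path-from-edge P f (rainbow⇒monochromaticEdge {𝒯 = 𝒯} rainbow small)

  clique₃ : Clique (underlying (cyclic P)) 3
  -- Under the constant colouring, a monochromatic path is just any path of two edges.
  clique₃ with _ , _ , _ , p , q , _ ← path {1} (λ _ → zero) (m≤m+n 3 (n * 2)) = triangle-clique P p q
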